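{- Let $n, k \ge 0$ be integers. Any multiplicative sublattice of co-rank $k$ in $\mathbb{Z}^{n+k}$ is of the form $g(L)$, where $g : \mathbb{Z}^n \to \mathbb{Z}^{n+k}$ is an acceptable map and $L$ is a multiplicative sublattice of full rank in $\mathbb{Z}^n$.
   Context: $\mathbb{Z}^n$ is the ring of $n$-tuples of integers with componentwise addition and multiplication. A sublattice of $\mathbb{Z}^n$ is a $\mathbb{Z}$-submodule $L \subseteq \mathbb{Z}^n$; its co-rank is $n - \operatorname{rank}_{\mathbb{Z}} L$, and it has full rank if its rank is $n$. A sublattice $L$ is multiplicative if $u \cdot v \in L$ for all $u,v \in L$ (it is not required to contain the identity $(1,\dots,1)$). An acceptable map is an injective map $g : \mathbb{Z}^n \to \mathbb{Z}^{n+k}$ of the form $g(x_1,\dots,x_n) = (y_1,\dots,y_{n+k})$ in which each coordinate $y_j$ is either identically $0$ or equal to $x_i$ for some fixed index $i$ depending only on $j$ (and $g$). -}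

module Defs where

open import Level using (Level; suc)
open import Data.Nat.Base as ℕ using (ℕ; _≤_)
open import Data.Integer.Base as ℤ using (ℤ; 0ℤ)
open import Data.Vec.Base using (Vec; map; zipWith; replicate; lookup)
open import Data.Vec.Functional as Vector using (Vector)
open import Data.Product.Base using (∃; _×_)
open import Data.Sum.Base using (_⊎_)
open import Function.Definitions using (Injective)
open import Relation.Unary using (Pred; _∈_)
open import Relation.Binary.PropositionalEquality.Core using (_≡_)

private
  variable
    ℓ : Level
    m n r : ℕ

infixl 6 _+_
infixl 7 _*_ _·_

ℤ^ : ℕ → Set
ℤ^ n = Vec ℤ n

0# : ℤ^ n
0# {n} = replicate n 0ℤ

_+_ : ℤ^ n → ℤ^ n → ℤ^ n
_+_ = zipWith ℤ._+_

_*_ : ℤ^ n → ℤ^ n → ℤ^ n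
_*_ = zipWith ℤ._*_

_·_ : ℤ → ℤ^ n → ℤ^ n
a · u = map (a ℤ.*_) u

record Sublattice (ℓ : Level) (n : ℕ) : Set (suc ℓ) where
  field
    Carrier  : Pred (ℤ^ n) ℓ
    0-closed : 0# ∈ Carrier
    +-closed : ∀ {u v} → u ∈ Carrier → v ∈ Carrier → u + v ∈ Carrier
    ·-closed : ∀ a {u} → u ∈ Carrier → a · u ∈ Carrier

open Sublattice public

Multiplicative : Sublattice ℓ n → Set ℓ
Multiplicative L = ∀ {u v} → u ∈ Carrier L → v ∈ Carrier L → u * v ∈ Carrier L

linearCombination : Vector ℤ r → Vector (ℤ^ n) r → ℤ^ n
linearCombination c v = Vector.foldr _+_ 0# (λ i → c i · v i)

LinearlyIndependent : Vector (ℤ^ n) r → Set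
LinearlyIndependent v = ∀ c → linearCombination c v ≡ 0# → ∀ i → c i ≡ 0ℤ

HasIndependentFamily : Sublattice ℓ n → ℕ → Set ℓ
HasIndependentFamily {n = n} L r =
  ∃ λ (v : Vector (ℤ^ n) r) → (∀ i → v i ∈ Carrier L) × LinearlyIndependent v

-- The rank is a relation rather than a function: the carrier is an arbitrary
-- predicate, so the maximal size of an independent family is not computable.
HasRank : Sublattice ℓ n → ℕ → Set ℓ
HasRank L r = HasIndependentFamily L r × (∀ s → HasIndependentFamily L s → s ≤ r)

HasCorank : Sublattice ℓ n → ℕ → Set ℓ
HasCorank {n = n} L k = ∃ λ r → HasRank L r × r ℕ.+ k ≡ n

FullRank : Sublattice ℓ n → Set ℓ
FullRank {n = n} L = HasRank L n

record Acceptable (g : ℤ^ m → ℤ^ n) : Set where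
  field
    injective  : Injective _≡_ _≡_ g
    coordinate : ∀ j → (∀ x → lookup (g x) j ≡ 0ℤ)
                     ⊎ (∃ λ i → ∀ x → lookup (g x) j ≡ lookup x i)

image : (ℤ^ m → ℤ^ n) → Pred (ℤ^ m) ℓ → Pred (ℤ^ n) ℓ
image g P y = ∃ λ x → x ∈ P × g x ≡ y

{-# OPTIONS --safe #-}
module Submission where

-- Let v₁, …, vₙ ∈ M be a maximal independent family, and attach to each
-- coordinate j the column (v₁(j), …, vₙ(j)).  A linear functional that kills
-- every vᵢ kills M, since otherwise the family could be extended.  Hence every
-- element of M is 0 at coordinates with zero column and agrees at coordinates
-- with equal columns.  It remains to see that there are exactly n distinct
-- nonzero columns.  There are at least n, because the vᵢ remain independent
-- when restricted to one coordinate per nonzero column.  There are at most n,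
-- because products of elements x − x(j′) applied to some y ∈ M produce, for each
-- chosen coordinate, an element of M that is nonzero there and zero at the
-- other chosen ones, and these elements are independent.

open import Defs
open import Level using (Level)
open import Data.Nat.Base using (ℕ) renaming (_+_ to _+ℕ_)
open import Data.Product.Base using (∃; _×_)
open import Relation.Unary using (_≐_)
open import Data.Empty using (⊥-elim)
open import Data.Fin.Base using (Fin; zero; suc; punchIn)
open import Data.Fin.Properties using (any?; ¬∀⟶∃¬) renaming (_≟_ to _≟ᶠ_)
open import Data.Integer.Base as ℤ using (ℤ; 0ℤ; 1ℤ)
import Data.Integer.Properties as ℤ
open import Data.Integer.Tactic.RingSolver using (solve-∀)
open import Data.Maybe.Base using (Maybe; just; nothing; maybe′)
open import Data.Nat.Base using (_≤_; z≤n; s≤s)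
import Data.Nat.Properties as ℕ
open import Data.Product.Base using (_,_; proj₁; proj₂)
open import Data.Sum.Base using (_⊎_; inj₁; inj₂; [_,_])
open import Data.Vec.Base using (lookup; tabulate; zipWith)
open import Data.Vec.Functional as Vector using (Vector; insertAt)
open import Data.Vec.Functional.Properties using (insertAt-lookup; insertAt-punchIn)
open import Data.Vec.Properties
  using (≡-dec; lookup-map; lookup-replicate; lookup-zipWith;
         lookup∘tabulate; tabulate∘lookup; tabulate-cong)
open import Function.Base using (_∘_; const; id)
open import Function.Definitions using (Injective)
open import Relation.Binary.Definitions using (DecidableEquality)
open import Relation.Binary.PropositionalEquality
  using (_≡_; _≢_; refl; sym; trans; cong; cong₂; subst; module ≡-Reasoning)
open import Relation.Nullary using (yes; no; ¬?)
open import Relation.Unary using (_∈_)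
open import Algebra.Properties.Semiring.Sum ℤ.+-*-semiring
  using (sum; sum-cong-≗; sum-remove; sum-replicate-zero; ∑-distrib-+; *-distribʳ-sum)

open ≡-Reasoning

private
  variable
    ℓ : Level
    m n N r d : ℕ

-- Coordinatewise arithmetic and sums.

lookup-ext : {u w : ℤ^ n} → (∀ j → lookup u j ≡ lookup w j) → u ≡ w
lookup-ext {u = u} {w} eq =
  trans (sym (tabulate∘lookup u)) (trans (tabulate-cong eq) (tabulate∘lookup w))

lookup-0# : (j : Fin n) → lookup 0# j ≡ 0ℤ
lookup-0# j = lookup-replicate j 0ℤ

lookup-+ : (j : Fin n) (u w : ℤ^ n) → lookup (u + w) j ≡ lookup u j ℤ.+ lookup w j
lookup-+ = lookup-zipWith ℤ._+_

lookup-* : (j : Fin n) (u w : ℤ^ n) → lookup (u * w) j ≡ lookup u j ℤ.* lookup w j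
lookup-* = lookup-zipWith ℤ._*_

lookup-· : (j : Fin n) (a : ℤ) (u : ℤ^ n) → lookup (a · u) j ≡ a ℤ.* lookup u j
lookup-· j a = lookup-map j (a ℤ.*_)

*-≢0 : ∀ {a b} → a ≢ 0ℤ → b ≢ 0ℤ → a ℤ.* b ≢ 0ℤ
*-≢0 {a} a≢0 b≢0 ab≡0 = [ a≢0 , b≢0 ] (ℤ.i*j≡0⇒i≡0∨j≡0 a ab≡0)

*-cancel-≢0 : ∀ a {b} → b ≢ 0ℤ → a ℤ.* b ≡ 0ℤ → a ≡ 0ℤ
*-cancel-≢0 a b≢0 ab≡0 = [ id , ⊥-elim ∘ b≢0 ] (ℤ.i*j≡0⇒i≡0∨j≡0 a ab≡0)

sum-zero : (f : Vector ℤ n) → (∀ i → f i ≡ 0ℤ) → sum f ≡ 0ℤ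
sum-zero {n} f f≡0 = trans (sum-cong-≗ f≡0) (sum-replicate-zero n)

-- The hypothesis is a disjunction rather than an implication from `i ≢ t`, so that it can be split
-- directly. `isolate` returns data of the same shape.
sum-single : (f : Vector ℤ n) (i : Fin n) → (∀ t → i ≡ t ⊎ f t ≡ 0ℤ) → sum f ≡ f i
sum-single f zero off =
  trans (cong (λ s → f zero ℤ.+ s) (sum-zero (f ∘ suc) (λ t → [ (λ ()) , id ] (off (suc t)))))
        (ℤ.+-identityʳ (f zero))
sum-single f (suc i) off with off zero
... | inj₂ f₀≡0 =
  trans (cong₂ ℤ._+_ f₀≡0 (sum-single (f ∘ suc) i off′)) (ℤ.+-identityˡ (f (suc i)))
  where
  off′ : ∀ t → i ≡ t ⊎ f (suc t) ≡ 0ℤ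
  off′ t with off (suc t)
  ... | inj₁ refl = inj₁ refl
  ... | inj₂ p    = inj₂ p

-- Linear relations read column by column.

lookup-linearCombination : (c : Vector ℤ r) (v : Vector (ℤ^ n) r) (j : Fin n) →
  lookup (linearCombination c v) j ≡ sum (λ i → c i ℤ.* lookup (v i) j)
lookup-linearCombination {ℕ.zero}  c v j = lookup-0# j
lookup-linearCombination {ℕ.suc r} c v j =
  trans (lookup-+ j (c zero · v zero) _)
        (cong₂ ℤ._+_ (lookup-· j (c zero) (v zero))
                     (lookup-linearCombination (c ∘ suc) (v ∘ suc) j))

combination-column : (c : Vector ℤ r) (v : Vector (ℤ^ n) r) → linearCombination c v ≡ 0# →
  ∀ j → sum (λ i → c i ℤ.* lookup (v i) j) ≡ 0ℤ
combination-column c v eq j =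
  trans (sym (lookup-linearCombination c v j))
        (trans (cong (λ u → lookup u j) eq) (lookup-0# j))

combination-≡0# : (c : Vector ℤ r) (v : Vector (ℤ^ n) r) →
  (∀ j → sum (λ i → c i ℤ.* lookup (v i) j) ≡ 0ℤ) → linearCombination c v ≡ 0#
combination-≡0# c v eq =
  lookup-ext λ j → trans (lookup-linearCombination c v j) (trans (eq j) (sym (lookup-0# j)))

-- A relation among the `w i` holds in each column of `w`, hence in each column of `v`, and so is a
-- relation among the `v i`.
independent-transfer : (v : Vector (ℤ^ m) r) (w : Vector (ℤ^ n) r) →
  (∀ j → (∀ i → lookup (v i) j ≡ 0ℤ) ⊎ (∃ λ j′ → ∀ i → lookup (v i) j ≡ lookup (w i) j′)) →
  LinearlyIndependent v → LinearlyIndependent w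
independent-transfer v w columns ind c cw≡0 = ind c (combination-≡0# c v column)
  where
  column : ∀ j → sum (λ i → c i ℤ.* lookup (v i) j) ≡ 0ℤ
  column j with columns j
  ... | inj₁ vj≡0 = sum-zero _ λ i → trans (cong (c i ℤ.*_) (vj≡0 i)) (ℤ.*-zeroʳ (c i))
  ... | inj₂ (j′ , vj≡wj′) =
    trans (sum-cong-≗ λ i → cong (c i ℤ.*_) (vj≡wj′ i)) (combination-column c w cw≡0 j′)

-- Independent families in `ℤ^ n` have at most `n` members.

-- Matrix form of `LinearlyIndependent`, in which rows and columns are dropped by reindexing.
RowsIndependent : (Fin r → Fin n → ℤ) → Set
RowsIndependent {r} A = ∀ (c : Vector ℤ r) → (∀ j → sum (λ i → c i ℤ.* A i j) ≡ 0ℤ) → ∀ i → c i ≡ 0ℤ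

-- One fraction-free Gaussian elimination step with pivot A i zero.
eliminate : (A : Fin (ℕ.suc r) → Fin (ℕ.suc n) → ℤ) → Fin (ℕ.suc r) → Fin r → Fin (ℕ.suc n) → ℤ
eliminate A i k j = A i zero ℤ.* A (punchIn i k) j ℤ.- A (punchIn i k) zero ℤ.* A i j

-- A relation `c` among the eliminated rows lifts to a relation `C` among the rows of `A`: the other
-- rows get `c k` times the pivot entry, and row `i` gets the coefficient that clears column `zero`.
-- Then `C` vanishes, and the nonzero pivot entry can be cancelled.
eliminate-independent : (A : Fin (ℕ.suc r) → Fin (ℕ.suc n) → ℤ) (i : Fin (ℕ.suc r)) →
  A i zero ≢ 0ℤ → RowsIndependent A → RowsIndependent (λ k → eliminate A i k ∘ suc)
eliminate-independent {r} A i p≢0 ind c cB≡0 k =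
  *-cancel-≢0 (c k) p≢0
    (trans (sym (insertAt-punchIn others i pivot k)) (ind C columns (punchIn i k)))
  where
  others : Vector ℤ r
  others k = c k ℤ.* A i zero
  pivot : ℤ
  pivot = sum (λ k → ℤ.- (c k ℤ.* A (punchIn i k) zero))
  C : Vector ℤ (ℕ.suc r)
  C = insertAt others i pivot

  collect : ∀ c p a h b → (ℤ.- (c ℤ.* h)) ℤ.* b ℤ.+ (c ℤ.* p) ℤ.* a ≡ c ℤ.* (p ℤ.* a ℤ.- h ℤ.* b)
  collect = solve-∀

  expand : ∀ j → sum (λ t → C t ℤ.* A t j) ≡ sum (λ k → c k ℤ.* eliminate A i k j)
  expand j = begin
    sum (λ t → C t ℤ.* A t j)
      ≡⟨ sum-remove {i = i} (λ t → C t ℤ.* A t j) ⟩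
    C i ℤ.* A i j ℤ.+ sum (λ k → C (punchIn i k) ℤ.* A (punchIn i k) j)
      ≡⟨ cong₂ ℤ._+_
           (trans (cong (ℤ._* A i j) (insertAt-lookup others i pivot))
                  (*-distribʳ-sum (A i j) (λ k → ℤ.- (c k ℤ.* A (punchIn i k) zero))))
           (sum-cong-≗ λ k → cong (ℤ._* A (punchIn i k) j) (insertAt-punchIn others i pivot k)) ⟩
    sum (λ k → ℤ.- (c k ℤ.* A (punchIn i k) zero) ℤ.* A i j)
      ℤ.+ sum (λ k → others k ℤ.* A (punchIn i k) j)
      ≡⟨ sym (∑-distrib-+ _ (λ k → others k ℤ.* A (punchIn i k) j)) ⟩
    sum (λ k → ℤ.- (c k ℤ.* A (punchIn i k) zero) ℤ.* A i j ℤ.+ others k ℤ.* A (punchIn i k) j)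
      ≡⟨ sum-cong-≗ (λ k → collect (c k) (A i zero) (A (punchIn i k) j) (A (punchIn i k) zero) (A i j)) ⟩
    sum (λ k → c k ℤ.* eliminate A i k j) ∎

  cancel : ∀ c p h → c ℤ.* (p ℤ.* h ℤ.- h ℤ.* p) ≡ 0ℤ
  cancel = solve-∀

  columns : ∀ j → sum (λ t → C t ℤ.* A t j) ≡ 0ℤ
  columns zero    = trans (expand zero)
    (sum-zero _ λ k → cancel (c k) (A i zero) (A (punchIn i k) zero))
  columns (suc j) = trans (expand (suc j)) (cB≡0 j)

rowsIndependent⇒≤ : (A : Fin r → Fin n → ℤ) → RowsIndependent A → r ≤ n
rowsIndependent⇒≤ {ℕ.zero}          A ind = z≤n
-- Without columns every coefficient vector is a relation, so the constant `1ℤ` would have to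
-- vanish.
rowsIndependent⇒≤ {ℕ.suc r} {ℕ.zero} A ind with ind (const 1ℤ) (λ ()) zero
... | ()
rowsIndependent⇒≤ {ℕ.suc r} {ℕ.suc n} A ind
  with any? (λ i → ¬? (A i zero ℤ.≟ 0ℤ))
... | yes (i , p≢0) = s≤s (rowsIndependent⇒≤ _ (eliminate-independent A i p≢0 ind))
... | no  no-pivot  = ℕ.m≤n⇒m≤1+n (rowsIndependent⇒≤ (λ i → A i ∘ suc) ind′)
  where
  first-zero : ∀ i → A i zero ≡ 0ℤ
  first-zero i with A i zero ℤ.≟ 0ℤ
  ... | yes p = p
  ... | no ¬p = ⊥-elim (no-pivot (i , ¬p))
  ind′ : RowsIndependent (λ i → A i ∘ suc)
  ind′ c eq = ind c λ where
    zero    → sum-zero _ λ i → trans (cong (c i ℤ.*_) (first-zero i)) (ℤ.*-zeroʳ (c i))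
    (suc j) → eq j

independent⇒≤ : (v : Vector (ℤ^ n) r) → LinearlyIndependent v → r ≤ n
independent⇒≤ v ind =
  rowsIndependent⇒≤ (λ i → lookup (v i)) λ c eq → ind c (combination-≡0# c v eq)

-- Linear functionals and maximal independent families.

record IsLinear (φ : ℤ^ n → ℤ) : Set where
  field
    additive    : ∀ u w → φ (u + w) ≡ φ u ℤ.+ φ w
    homogeneous : ∀ a u → φ (a · u) ≡ a ℤ.* φ u

open IsLinear

lookup-linear : (j : Fin n) → IsLinear (λ u → lookup u j)
lookup-linear j = record { additive = lookup-+ j ; homogeneous = lookup-· j }

-- If this functional vanishes on a lattice, its elements agree at `j` and `j′`; this handles equal
-- columns, as `lookup-linear` handles zero columns.
difference-linear : (j j′ : Fin n) → IsLinear (λ u → lookup u j ℤ.- lookup u j′)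
difference-linear j j′ = record
  { additive    = λ u w → trans (cong₂ ℤ._-_ (lookup-+ j u w) (lookup-+ j′ u w))
                    (regroup (lookup u j) (lookup w j) (lookup u j′) (lookup w j′))
  ; homogeneous = λ a u → trans (cong₂ ℤ._-_ (lookup-· j a u) (lookup-· j′ a u))
                    (factor a (lookup u j) (lookup u j′))
  }
  where
  regroup : ∀ x y x′ y′ → (x ℤ.+ y) ℤ.- (x′ ℤ.+ y′) ≡ (x ℤ.- x′) ℤ.+ (y ℤ.- y′)
  regroup = solve-∀
  factor : ∀ a x x′ → a ℤ.* x ℤ.- a ℤ.* x′ ≡ a ℤ.* (x ℤ.- x′)
  factor = solve-∀

0·≡0# : (u : ℤ^ n) → 0ℤ · u ≡ 0#
0·≡0# u = lookup-ext λ j → trans (lookup-· j 0ℤ u) (sym (lookup-0# j))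

0#+≡ : (u : ℤ^ n) → 0# + u ≡ u
0#+≡ u = lookup-ext λ j → trans (lookup-+ j 0# u)
  (trans (cong (ℤ._+ lookup u j) (lookup-0# j)) (ℤ.+-identityˡ (lookup u j)))

linear-0# : {φ : ℤ^ n → ℤ} → IsLinear φ → φ 0# ≡ 0ℤ
linear-0# {φ = φ} lin = trans (cong φ (sym (0·≡0# 0#))) (homogeneous lin 0ℤ 0#)

linear-vanishes : {φ : ℤ^ n → ℤ} → IsLinear φ → (c : Vector ℤ r) (v : Vector (ℤ^ n) r) →
  (∀ i → φ (v i) ≡ 0ℤ) → φ (linearCombination c v) ≡ 0ℤ
linear-vanishes {r = ℕ.zero}  lin c v φv≡0 = linear-0# lin
linear-vanishes {r = ℕ.suc r} lin c v φv≡0 =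
  trans (additive lin (c zero · v zero) _)
    (cong₂ ℤ._+_
      (trans (homogeneous lin (c zero) (v zero))
             (trans (cong (c zero ℤ.*_) (φv≡0 zero)) (ℤ.*-zeroʳ (c zero))))
      (linear-vanishes lin (c ∘ suc) (v ∘ suc) (φv≡0 ∘ suc)))

-- Applying `φ` to a relation leaves only `c zero ℤ.* φ u`, so `c zero` is 0 and the rest is a
-- relation among the `v i`.
extend-independent : {φ : ℤ^ n → ℤ} → IsLinear φ → (v : Vector (ℤ^ n) r) →
  (∀ i → φ (v i) ≡ 0ℤ) → LinearlyIndependent v →
  ∀ u → φ u ≢ 0ℤ → LinearlyIndependent (u Vector.∷ v)
extend-independent {φ = φ} lin v φv≡0 ind u φu≢0 c eq = λ where
    zero    → c₀≡0
    (suc i) → ind (c ∘ suc) rest≡0# i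
  where
  rest : ℤ^ _
  rest = linearCombination (c ∘ suc) v
  c₀≡0 : c zero ≡ 0ℤ
  c₀≡0 = *-cancel-≢0 (c zero) φu≢0 (begin
    c zero ℤ.* φ u                ≡⟨ sym (ℤ.+-identityʳ _) ⟩
    c zero ℤ.* φ u ℤ.+ 0ℤ         ≡⟨ sym (cong₂ ℤ._+_ (homogeneous lin (c zero) u)
                                                      (linear-vanishes lin (c ∘ suc) v φv≡0)) ⟩
    φ (c zero · u) ℤ.+ φ rest     ≡⟨ sym (additive lin (c zero · u) rest) ⟩
    φ (c zero · u + rest)         ≡⟨ cong φ eq ⟩
    φ 0#                          ≡⟨ linear-0# lin ⟩
    0ℤ                            ∎)
  rest≡0# : rest ≡ 0#
  rest≡0# = begin
    rest               ≡⟨ sym (0#+≡ rest) ⟩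
    0# + rest          ≡⟨ cong (_+ rest) (sym (trans (cong (_· u) c₀≡0) (0·≡0# u))) ⟩
    c zero · u + rest  ≡⟨ eq ⟩
    0#                 ∎

maximal⇒vanishes : (M : Sublattice ℓ n) (v : Vector (ℤ^ n) r) → (∀ i → v i ∈ Carrier M) →
  LinearlyIndependent v → (∀ s → HasIndependentFamily M s → s ≤ r) →
  {φ : ℤ^ n → ℤ} → IsLinear φ → (∀ i → φ (v i) ≡ 0ℤ) → ∀ {u} → u ∈ Carrier M → φ u ≡ 0ℤ
-- Equality in `ℤ` is decidable, which makes the argument by contradiction constructive.
maximal⇒vanishes M v v∈M ind bound {φ} lin φv≡0 {u} u∈M with φ u ℤ.≟ 0ℤ
... | yes φu≡0 = φu≡0
... | no  φu≢0 = ⊥-elim (ℕ.1+n≰n (bound _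
  ( u Vector.∷ v
  , (λ { zero → u∈M ; (suc i) → v∈M i })
  , extend-independent lin v φv≡0 ind u φu≢0)))

-- Representatives of the distinct nonzero values.

-- `ρ` picks the last occurrence of each value other than `z`: an index is added only if its value
-- is not already represented further on.
distinctValues : {A : Set} → DecidableEquality A → (z : A) (f : Fin N → A) →
  ∃ λ d → ∃ λ (ρ : Fin d → Fin N) →
    (∀ i → f (ρ i) ≢ z) × Injective _≡_ _≡_ (f ∘ ρ) × (∀ j → f j ≡ z ⊎ (∃ λ i → f j ≡ f (ρ i)))
distinctValues {N = ℕ.zero}  _≟_ z f = 0 , (λ ()) , (λ ()) , (λ { {()} }) , (λ ())
distinctValues {N = ℕ.suc N} _≟_ z f
  with distinctValues _≟_ z (f ∘ suc)
... | d , ρ , ρ≢z , ρ-inj , cover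
  with f zero ≟ z | any? (λ i → f zero ≟ f (suc (ρ i)))
... | yes f₀≡z | _          = d , suc ∘ ρ , ρ≢z , ρ-inj ,
  λ { zero → inj₁ f₀≡z ; (suc j) → cover j }
... | no  _    | yes old    = d , suc ∘ ρ , ρ≢z , ρ-inj ,
  λ { zero → inj₂ old ; (suc j) → cover j }
... | no  f₀≢z | no  fresh  = ℕ.suc d , ρ′ , ρ′≢z , (λ {i} {i′} → ρ′-inj i i′) , cover′
  where
  ρ′ : Fin (ℕ.suc d) → Fin (ℕ.suc N)
  ρ′ zero    = zero
  ρ′ (suc i) = suc (ρ i)
  ρ′≢z : ∀ i → f (ρ′ i) ≢ z
  ρ′≢z zero    = f₀≢z
  ρ′≢z (suc i) = ρ≢z i
  ρ′-inj : ∀ i i′ → f (ρ′ i) ≡ f (ρ′ i′) → i ≡ i′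
  ρ′-inj zero    zero     eq = refl
  ρ′-inj zero    (suc i′) eq = ⊥-elim (fresh (i′ , eq))
  ρ′-inj (suc i) zero     eq = ⊥-elim (fresh (i , sym eq))
  ρ′-inj (suc i) (suc i′) eq = cong suc (ρ-inj eq)
  cover′ : ∀ j → f j ≡ z ⊎ (∃ λ i → f j ≡ f (ρ′ i))
  cover′ zero = inj₂ (zero , refl)
  cover′ (suc j) with cover j
  ... | inj₁ eq       = inj₁ eq
  ... | inj₂ (i , eq) = inj₂ (suc i , eq)

-- Isolating coordinates by multiplication.

-- Turns distinct columns into an explicit family member that tells them apart.
tabulate-≢ : {f g : Fin n → ℤ} → tabulate f ≢ tabulate g → ∃ λ i → f i ≢ g i
tabulate-≢ {n} {f} {g} f≢g =
  ¬∀⟶∃¬ n (λ i → f i ≡ g i) (λ i → f i ℤ.≟ g i) (f≢g ∘ tabulate-cong)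

-- Q t marks the coordinates ρ t on which nothing is required.  For the others,
-- multiplying by x − x(ρ t) kills the coordinate ρ t and keeps the coordinate j nonzero.
isolate : (M : Sublattice ℓ N) → Multiplicative M → (j : Fin N) →
  (ρ : Fin d → Fin N) (Q : Fin d → Set) →
  (∀ t → Q t ⊎ (∃ λ x → x ∈ Carrier M × lookup x j ≢ lookup x (ρ t))) →
  ∀ {y} → y ∈ Carrier M → lookup y j ≢ 0ℤ →
  ∃ λ w → w ∈ Carrier M × lookup w j ≢ 0ℤ × (∀ t → Q t ⊎ lookup w (ρ t) ≡ 0ℤ)
isolate {d = ℕ.zero}  M mult j ρ Q sep {y} y∈M yj≢0 = y , y∈M , yj≢0 , λ ()
isolate {d = ℕ.suc d} M mult j ρ Q sep y∈M yj≢0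
  with isolate M mult j (ρ ∘ suc) (Q ∘ suc) (sep ∘ suc) y∈M yj≢0 | sep zero
... | w , w∈M , wj≢0 , w-off | inj₁ q = w , w∈M , wj≢0 , λ where
  zero    → inj₁ q
  (suc t) → w-off t
... | w , w∈M , wj≢0 , w-off | inj₂ (x , x∈M , xj≢) =
  w′ , +-closed M (mult x∈M w∈M) (·-closed M (ℤ.- a) w∈M) , w′j≢0 , w′-off
  where
  a : ℤ
  a = lookup x (ρ zero)
  -- The constant vector with entries `a` may lie outside `M`, so the product of `x − a` with `w` is
  -- expanded into terms that lie in `M`.
  w′ : ℤ^ _
  w′ = x * w + (ℤ.- a) · w
  factor : ∀ x w a → x ℤ.* w ℤ.+ (ℤ.- a) ℤ.* w ≡ (x ℤ.- a) ℤ.* w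
  factor = solve-∀
  lookup-w′ : ∀ i → lookup w′ i ≡ (lookup x i ℤ.- a) ℤ.* lookup w i
  lookup-w′ i = trans (lookup-+ i (x * w) ((ℤ.- a) · w))
    (trans (cong₂ ℤ._+_ (lookup-* i x w) (lookup-· i (ℤ.- a) w)) (factor (lookup x i) (lookup w i) a))
  w′j≢0 : lookup w′ j ≢ 0ℤ
  w′j≢0 eq = *-≢0 (xj≢ ∘ ℤ.i-j≡0⇒i≡j (lookup x j) a) wj≢0 (trans (sym (lookup-w′ j)) eq)
  w′-off : ∀ t → Q t ⊎ lookup w′ (ρ t) ≡ 0ℤ
  w′-off zero = inj₂ (trans (lookup-w′ (ρ zero)) (cong (ℤ._* lookup w (ρ zero))
    (ℤ.i≡j⇒i-j≡0 {a} refl)))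
  w′-off (suc t) with w-off t
  ... | inj₁ q   = inj₁ q
  ... | inj₂ w≡0 = inj₂ (trans (lookup-w′ (ρ (suc t)))
    (trans (cong ((lookup x (ρ (suc t)) ℤ.- a) ℤ.*_) w≡0) (ℤ.*-zeroʳ (lookup x (ρ (suc t)) ℤ.- a))))

-- At coordinate `ρ i` only the `i`-th term of a relation survives, with a nonzero factor.
diagonal-independent : (ρ : Fin d → Fin N) (w : Vector (ℤ^ N) d) →
  (∀ i → lookup (w i) (ρ i) ≢ 0ℤ) → (∀ i t → i ≡ t ⊎ lookup (w i) (ρ t) ≡ 0ℤ) →
  LinearlyIndependent w
diagonal-independent ρ w diag off c eq i = *-cancel-≢0 (c i) (diag i) (begin
    c i ℤ.* lookup (w i) (ρ i)                ≡⟨ sym (sum-single _ i off′) ⟩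
    sum (λ t → c t ℤ.* lookup (w t) (ρ i))    ≡⟨ combination-column c w eq (ρ i) ⟩
    0ℤ                                        ∎)
  where
  off′ : ∀ t → i ≡ t ⊎ c t ℤ.* lookup (w t) (ρ i) ≡ 0ℤ
  off′ t with off t i
  ... | inj₁ refl = inj₁ refl
  ... | inj₂ w≡0  = inj₂ (trans (cong (c t ℤ.*_) w≡0) (ℤ.*-zeroʳ (c t)))

-- Restriction, expansion and the pulled-back lattice.

restrict : (Fin d → Fin N) → ℤ^ N → ℤ^ d
restrict ρ y = tabulate (lookup y ∘ ρ)

-- A `Vec` rather than a function, so that columns have decidable equality.
column : Vector (ℤ^ N) r → Fin N → ℤ^ r
column v j = tabulate (λ i → lookup (v i) j)

column-≡ : (v : Vector (ℤ^ N) r) {j : Fin N} {f : Fin r → ℤ} →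
  column v j ≡ tabulate f → ∀ i → lookup (v i) j ≡ f i
column-≡ v {j} {f} eq i = trans (sym (lookup∘tabulate (λ i → lookup (v i) j) i))
  (trans (cong (λ u → lookup u i) eq) (lookup∘tabulate f i))

-- κ j is the index of the source coordinate copied to j, or nothing where the map is 0.
expand : (Fin N → Maybe (Fin n)) → ℤ^ n → ℤ^ N
expand κ x = tabulate (maybe′ (lookup x) 0ℤ ∘ κ)

module _ (κ : Fin N → Maybe (Fin n)) where

  lookup-expand : ∀ x j → lookup (expand κ x) j ≡ maybe′ (lookup x) 0ℤ (κ j)
  lookup-expand x = lookup∘tabulate (maybe′ (lookup x) 0ℤ ∘ κ)

  expand-0# : expand κ 0# ≡ 0#
  expand-0# = lookup-ext λ j → trans (lookup-expand 0# j) (trans (zeros (κ j)) (sym (lookup-0# j)))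
    where
    zeros : ∀ o → maybe′ (lookup 0#) 0ℤ o ≡ 0ℤ
    zeros nothing  = refl
    zeros (just i) = lookup-0# i

  -- Covers addition and multiplication at once; `f00≡0` is what the positions filled with 0
  -- require.
  expand-zipWith : (f : ℤ → ℤ → ℤ) → f 0ℤ 0ℤ ≡ 0ℤ →
    ∀ u w → expand κ (zipWith f u w) ≡ zipWith f (expand κ u) (expand κ w)
  expand-zipWith f f00≡0 u w = lookup-ext λ j → begin
    lookup (expand κ (zipWith f u w)) j                       ≡⟨ lookup-expand (zipWith f u w) j ⟩
    maybe′ (lookup (zipWith f u w)) 0ℤ (κ j)                  ≡⟨ pointwise (κ j) ⟩
    f (maybe′ (lookup u) 0ℤ (κ j)) (maybe′ (lookup w) 0ℤ (κ j))
      ≡⟨ sym (cong₂ f (lookup-expand u j) (lookup-expand w j)) ⟩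
    f (lookup (expand κ u) j) (lookup (expand κ w) j)
      ≡⟨ sym (lookup-zipWith f j (expand κ u) (expand κ w)) ⟩
    lookup (zipWith f (expand κ u) (expand κ w)) j            ∎
    where
    pointwise : ∀ o → maybe′ (lookup (zipWith f u w)) 0ℤ o
                      ≡ f (maybe′ (lookup u) 0ℤ o) (maybe′ (lookup w) 0ℤ o)
    pointwise nothing  = sym f00≡0
    pointwise (just i) = lookup-zipWith f i u w

  expand-· : ∀ a u → expand κ (a · u) ≡ a · expand κ u
  expand-· a u = lookup-ext λ j → begin
    lookup (expand κ (a · u)) j            ≡⟨ lookup-expand (a · u) j ⟩
    maybe′ (lookup (a · u)) 0ℤ (κ j)       ≡⟨ pointwise (κ j) ⟩
    a ℤ.* maybe′ (lookup u) 0ℤ (κ j)       ≡⟨ sym (cong (a ℤ.*_) (lookup-expand u j)) ⟩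
    a ℤ.* lookup (expand κ u) j            ≡⟨ sym (lookup-· j a (expand κ u)) ⟩
    lookup (a · expand κ u) j              ∎
    where
    pointwise : ∀ o → maybe′ (lookup (a · u)) 0ℤ o ≡ a ℤ.* maybe′ (lookup u) 0ℤ o
    pointwise nothing  = sym (ℤ.*-zeroʳ a)
    pointwise (just i) = lookup-· i a u

  pullback : Sublattice ℓ N → Sublattice ℓ n
  pullback M = record
    { Carrier  = λ x → expand κ x ∈ Carrier M
    ; 0-closed = subst (Carrier M) (sym expand-0#) (0-closed M)
    ; +-closed = λ {u} {w} u∈ w∈ →
        subst (Carrier M) (sym (expand-zipWith ℤ._+_ refl u w)) (+-closed M u∈ w∈)
    ; ·-closed = λ a {u} u∈ → subst (Carrier M) (sym (expand-· a u)) (·-closed M a u∈)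
    }

  pullback-multiplicative : (M : Sublattice ℓ N) → Multiplicative M → Multiplicative (pullback M)
  pullback-multiplicative M mult {u} {w} u∈ w∈ =
    subst (Carrier M) (sym (expand-zipWith ℤ._*_ refl u w)) (mult u∈ w∈)

  module _ (ρ : Fin n → Fin N) (κ∘ρ : ∀ i → κ (ρ i) ≡ just i) where

    -- Makes `restrict ρ` a left inverse of `expand κ`, whence injectivity.
    lookup-expand-ρ : ∀ x i → lookup (expand κ x) (ρ i) ≡ lookup x i
    lookup-expand-ρ x i = trans (lookup-expand x (ρ i)) (cong (maybe′ (lookup x) 0ℤ) (κ∘ρ i))

    expand-acceptable : Acceptable (expand κ)
    expand-acceptable = record
      { injective  = λ {x} {y} eq → lookup-ext λ i →
          trans (sym (lookup-expand-ρ x i))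
                (trans (cong (λ u → lookup u (ρ i)) eq) (lookup-expand-ρ y i))
      ; coordinate = coordinate
      }
      where
      coordinate : ∀ j → (∀ x → lookup (expand κ x) j ≡ 0ℤ)
                         ⊎ (∃ λ i → ∀ x → lookup (expand κ x) j ≡ lookup x i)
      coordinate j with κ j in eq
      ... | nothing = inj₁ λ x → trans (lookup-expand x j) (cong (maybe′ (lookup x) 0ℤ) eq)
      ... | just i  = inj₂ (i , λ x → trans (lookup-expand x j) (cong (maybe′ (lookup x) 0ℤ) eq))

    -- By `fixed`, a maximal family of `M` restricts to the pullback without losing independence.
    -- Conversely, independent families of the pullback expand into `M`, so the bound carries over.
    pullback-fullRank : (M : Sublattice ℓ N) → (∀ {y} → y ∈ Carrier M → expand κ (restrict ρ y) ≡ y) →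
      HasRank M n → FullRank (pullback M)
    pullback-fullRank M fixed ((v , v∈M , ind) , bound) =
      ( restrict ρ ∘ v
      , (λ i → subst (Carrier M) (sym (fixed (v∈M i))) (v∈M i))
      , independent-transfer v (restrict ρ ∘ v) columns ind
      )
      , λ s (w , w∈ , w-ind) → bound s
          ( expand κ ∘ w , w∈
          , independent-transfer w (expand κ ∘ w)
              (λ j → inj₂ (ρ j , λ i → sym (lookup-expand-ρ (w i) j))) w-ind )
      where
      lookup-v : ∀ i j → lookup (v i) j ≡ maybe′ (lookup (restrict ρ (v i))) 0ℤ (κ j)
      lookup-v i j = trans (sym (cong (λ u → lookup u j) (fixed (v∈M i))))
                           (lookup-expand (restrict ρ (v i)) j)
      columns : ∀ j → (∀ i → lookup (v i) j ≡ 0ℤ)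
                      ⊎ (∃ λ t → ∀ i → lookup (v i) j ≡ lookup (restrict ρ (v i)) t)
      columns j with κ j in eq
      ... | nothing = inj₁ λ i →
        trans (lookup-v i j) (cong (maybe′ (lookup (restrict ρ (v i))) 0ℤ) eq)
      ... | just t  = inj₂ (t , λ i →
        trans (lookup-v i j) (cong (maybe′ (lookup (restrict ρ (v i))) 0ℤ) eq))

-- Counting the columns and assembling the theorem.

-- The zero vector in tabulated form, to which `tabulate-≢` and `column-≡` apply directly.
zeroColumn : ℤ^ r
zeroColumn = tabulate (const 0ℤ)

columnCount : (M : Sublattice ℓ N) → Multiplicative M → (v : Vector (ℤ^ N) r) →
  (∀ i → v i ∈ Carrier M) → LinearlyIndependent v → (∀ s → HasIndependentFamily M s → s ≤ r) →
  (ρ : Fin d → Fin N) → (∀ i → column v (ρ i) ≢ zeroColumn) → Injective _≡_ _≡_ (column v ∘ ρ) →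
  (∀ j → column v j ≡ zeroColumn ⊎ (∃ λ i → column v j ≡ column v (ρ i))) → d ≡ r
columnCount {N = N} {r} {d} M mult v v∈M ind bound ρ ρ≢0 ρ-inj cover =
  ℕ.≤-antisym
    (bound d (w , (λ i → proj₁ (proj₂ (isolated i)))
             , diagonal-independent ρ w (λ i → proj₁ (proj₂ (proj₂ (isolated i))))
                                        (λ i → proj₂ (proj₂ (proj₂ (isolated i))))))
    (independent⇒≤ (restrict ρ ∘ v) (independent-transfer v (restrict ρ ∘ v) columns ind))
  where
  isolated : ∀ i → ∃ λ w → w ∈ Carrier M × lookup w (ρ i) ≢ 0ℤ ×
                           (∀ t → i ≡ t ⊎ lookup w (ρ t) ≡ 0ℤ)
  -- Only `ρ i` itself is exempt from being killed. The starting element is a family member that is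
  -- nonzero there, found from the nonzero column.
  isolated i = isolate M mult (ρ i) ρ (i ≡_) separate (v∈M l) vl≢0
    where
    nonzero : ∃ λ l → lookup (v l) (ρ i) ≢ 0ℤ
    nonzero = tabulate-≢ (ρ≢0 i)
    l : Fin r
    l = proj₁ nonzero
    vl≢0 : lookup (v l) (ρ i) ≢ 0ℤ
    vl≢0 = proj₂ nonzero
    separate : ∀ t → i ≡ t ⊎ (∃ λ x → x ∈ Carrier M × lookup x (ρ i) ≢ lookup x (ρ t))
    separate t with i ≟ᶠ t
    ... | yes i≡t = inj₁ i≡t
    ... | no  i≢t with tabulate-≢ (i≢t ∘ ρ-inj)
    ...   | m , vm≢ = inj₂ (v m , v∈M m , vm≢)
  w : Vector (ℤ^ N) d
  w i = proj₁ (isolated i)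
  columns : ∀ j → (∀ i → lookup (v i) j ≡ 0ℤ)
                  ⊎ (∃ λ t → ∀ i → lookup (v i) j ≡ lookup (restrict ρ (v i)) t)
  columns j with cover j
  ... | inj₁ eq       = inj₁ (column-≡ v eq)
  ... | inj₂ (t , eq) = inj₂ (t , λ i →
    trans (column-≡ v eq i) (sym (lookup∘tabulate (lookup (v i) ∘ ρ) t)))

multiplicative-rank : (M : Sublattice ℓ N) → Multiplicative M → HasRank M n →
  ∃ λ (g : ℤ^ n → ℤ^ N) → Acceptable g ×
    (∃ λ (L : Sublattice ℓ n) → Multiplicative L × FullRank L × Carrier M ≐ image g (Carrier L))
multiplicative-rank {N = N} {n} M mult rank@((v , v∈M , ind) , bound)
  with distinctValues (≡-dec ℤ._≟_) zeroColumn (column v)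
... | d , ρ , ρ≢0 , ρ-inj , cover
  with columnCount M mult v v∈M ind bound ρ ρ≢0 ρ-inj cover
-- Identifies `d` with `n`, so that `ρ` is indexed by the source coordinates.
... | refl =
  expand κ , expand-acceptable κ ρ κ∘ρ ,
  pullback κ M , (λ {u} {w} → pullback-multiplicative κ M mult {u} {w}) ,
  pullback-fullRank κ ρ κ∘ρ M fixed rank ,
  (λ {y} y∈M → restrict ρ y , subst (Carrier M) (sym (fixed y∈M)) y∈M , fixed y∈M) ,
  (λ { (x , gx∈M , refl) → gx∈M })
  where
  κ : Fin N → Maybe (Fin n)
  κ j = [ const nothing , just ∘ proj₁ ] (cover j)
  κ∘ρ : ∀ i → κ (ρ i) ≡ just i
  -- `cover` could return any representative with the same column; `ρ-inj` forces it to be `i`.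
  κ∘ρ i with cover (ρ i)
  ... | inj₁ eq       = ⊥-elim (ρ≢0 i eq)
  ... | inj₂ (t , eq) = cong just (sym (ρ-inj eq))
  vanishes : {φ : ℤ^ N → ℤ} → IsLinear φ → (∀ i → φ (v i) ≡ 0ℤ) → ∀ {y} → y ∈ Carrier M → φ y ≡ 0ℤ
  vanishes = maximal⇒vanishes M v v∈M ind bound
  class : ∀ {y} → y ∈ Carrier M → ∀ j → maybe′ (lookup (restrict ρ y)) 0ℤ (κ j) ≡ lookup y j
  class {y} y∈M j with cover j
  ... | inj₁ eq       = sym (vanishes (lookup-linear j) (column-≡ v eq) y∈M)
  ... | inj₂ (t , eq) = trans (lookup∘tabulate (lookup y ∘ ρ) t)
    (sym (ℤ.i-j≡0⇒i≡j (lookup y j) (lookup y (ρ t))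
      (vanishes (difference-linear j (ρ t)) (λ i → ℤ.i≡j⇒i-j≡0 (column-≡ v eq i)) y∈M)))
  fixed : ∀ {y} → y ∈ Carrier M → expand κ (restrict ρ y) ≡ y
  fixed {y} y∈M = lookup-ext λ j → trans (lookup-expand κ (restrict ρ y) j) (class y∈M j)

theorem8 : ∀ {ℓ : Level} (n k : ℕ) (M : Sublattice ℓ (n +ℕ k)) →
    Multiplicative M → HasCorank M k →
    ∃ λ (g : ℤ^ n → ℤ^ (n +ℕ k)) → Acceptable g ×
    (∃ λ (L : Sublattice ℓ n) →
    Multiplicative L × FullRank L × Carrier M ≐ image g (Carrier L))
-- Cancelling `k` turns co-rank `k` into rank `n`.
theorem8 n k M mult (r , rank , r+k≡n+k) with ℕ.+-cancelʳ-≡ k r n r+k≡n+k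
... | refl = multiplicative-rank M mult rank
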